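{- Let $G$ be a finite group and suppose $G$ has a subgroup $H$ admitting a nontrivial homomorphism $\phi: H \to \{\pm 1\}$. Then there is a function $f: G \to \{\pm 1\}$ with $\mathbb{E}_{x\in G} f(x) = 0$ and \[ \Pr_{x,y}\,[f(x)f(y) = f(xy)] \ge \frac{1}{2}\left(1 + \frac{1}{2}\frac{|H|}{|G|}\left(1 - \frac{|N(H)|}{|G|}\right) + \frac{|H|^2}{|G|^2}\right), \] where $x,y$ are chosen uniformly and independently from $G$ and $N(H) = \{c \in G : cHc^{ -1} = H\}$ is the normalizer of $H$ in $G$.
   Context: $\mathbb{E}$ denotes the average over the uniform distribution on $G$. -}

module Defs where

open import Algebra.Bundles using (Group)
open import Algebra.Morphism.Structures using (IsGroupHomomorphism)
open import Data.Fin.Base using (Fin)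
import Data.Fin.Properties as Fin
open import Data.Integer.Base as ℤ using (ℤ; +_; _◃_)
open import Data.List.Base using (List; length; filter; map; foldr; tabulate; cartesianProduct)
open import Data.Nat.Base as ℕ using (ℕ; NonZero)
import Data.Nat.Properties as ℕ
open import Data.Product.Base using (Σ; ∃; ∃-syntax; _×_; _,_; proj₁)
open import Data.Rational.Base as ℚ using (ℚ)
open import Data.Sign.Base as Sign using (Sign)
import Data.Sign.Properties as Sign
open import Function.Base using (_∘_)
open import Function.Bundles using (Inverse; _⟶ₛ_; _⟨$⟩_)
open import Level using (Level; _⊔_; 0ℓ) renaming (suc to lsuc)
open import Relation.Binary.Bundles using (Setoid)
open import Relation.Binary.Definitions using (_Respects_)
open import Relation.Binary.PropositionalEquality.Core as ≡ using (_≡_)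
import Relation.Binary.PropositionalEquality.Properties as ≡
open import Relation.Nullary.Decidable using (Dec; map′; _×-dec_; _→-dec_)
open import Relation.Nullary.Negation using (¬_)
open import Relation.Unary using (Pred; Decidable; _∈_; _≐_)

record FiniteGroup (c ℓ : Level) : Set (lsuc (c ⊔ ℓ)) where
  field
    group       : Group c ℓ
    order       : ℕ
    enumeration : Inverse (Group.setoid group) (≡.setoid (Fin order))

  open Group group public hiding (_-_)
  open Inverse enumeration public using ()
    renaming (to to index; from to element; to-cong to index-cong)

  element-index : ∀ x → element (index x) ≈ x
  element-index x = Inverse.inverseʳ enumeration ≡.refl

  instance
    order-nonZero : NonZero order
    order-nonZero = Fin.nonZeroIndex (index ε)

    order²-nonZero : NonZero (order ℕ.* order)
    order²-nonZero = ℕ.m*n≢0 order order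

  _≈?_ : ∀ x y → Dec (x ≈ y)
  x ≈? y = map′
    (λ eq → trans (sym (element-index x))
              (trans (reflexive (≡.cong element eq)) (element-index y)))
    index-cong
    (index x Fin.≟ index y)

  any? : ∀ {p} {P : Pred Carrier p} → P Respects _≈_ → Decidable P → Dec (∃ P)
  any? resp P? = map′
    (λ (i , Pi) → element i , Pi)
    (λ (x , Px) → index x , resp (sym (element-index x)) Px)
    (Fin.any? (P? ∘ element))

  all? : ∀ {p} {P : Pred Carrier p} → P Respects _≈_ → Decidable P → Dec (∀ {x} → P x)
  all? resp P? = map′
    (λ ∀P {x} → resp (element-index x) (∀P (index x)))
    (λ ∀P i → ∀P)
    (Fin.all? (P? ∘ element))

  -- Every element of the group occurs exactly once, up to _≈_.
  elements : List Carrier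
  elements = tabulate element

  -- Only meaningful as a cardinality for predicates respecting _≈_.
  card : ∀ {p} {P : Pred Carrier p} → Decidable P → ℕ
  card P? = length (filter P? elements)

  𝔼 : (Carrier → ℤ) → ℚ
  𝔼 g = foldr ℤ._+_ ℤ.0ℤ (map g elements) ℚ./ order

  -- x and y uniform and independent: (x , y) is uniform on G × G.
  Pr : ∀ {p} {P : Pred (Carrier × Carrier) p} → Decidable P → ℚ
  Pr P? = + length (filter P? (cartesianProduct elements elements)) ℚ./ (order ℕ.* order)

-- Membership is required to be decidable so that a subgroup has a cardinality;
-- classically this is no restriction.

record Subgroup {c ℓ : Level} (G : FiniteGroup c ℓ) (p : Level) : Set (c ⊔ ℓ ⊔ lsuc p) where
  private module G = FiniteGroup G
  field
    Member    : Pred G.Carrier p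
    member?   : Decidable Member
    resp      : Member Respects G._≈_
    ε-closed  : G.ε ∈ Member
    ∙-closed  : ∀ {x y} → x ∈ Member → y ∈ Member → x G.∙ y ∈ Member
    ⁻¹-closed : ∀ {x} → x ∈ Member → x G.⁻¹ ∈ Member

  group : Group (c ⊔ p) ℓ
  group = record
    { Carrier = Σ G.Carrier Member
    ; _≈_     = λ x y → proj₁ x G.≈ proj₁ y
    ; _∙_     = λ (x , x∈H) (y , y∈H) → x G.∙ y , ∙-closed x∈H y∈H
    ; ε       = G.ε , ε-closed
    ; _⁻¹     = λ (x , x∈H) → x G.⁻¹ , ⁻¹-closed x∈H
    ; isGroup = record
      { isMonoid = record
        { isSemigroup = record
          { isMagma = record
            { isEquivalence = record { refl = G.refl ; sym = G.sym ; trans = G.trans }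
            ; ∙-cong        = G.∙-cong
            }
          ; assoc = λ x y z → G.assoc (proj₁ x) (proj₁ y) (proj₁ z)
          }
        ; identity = (λ x → G.identityˡ (proj₁ x)) , (λ x → G.identityʳ (proj₁ x))
        }
      ; inverse = (λ x → G.inverseˡ (proj₁ x)) , (λ x → G.inverseʳ (proj₁ x))
      ; ⁻¹-cong = G.⁻¹-cong
      }
    }

  -- c H c⁻¹
  Conjugate : G.Carrier → Pred G.Carrier (c ⊔ ℓ ⊔ p)
  Conjugate c x = ∃[ h ] h ∈ Member × x G.≈ c G.∙ h G.∙ c G.⁻¹

  Normalizer : Pred G.Carrier (c ⊔ ℓ ⊔ p)
  Normalizer c = Conjugate c ≐ Member

  conjugate? : ∀ c → Decidable (Conjugate c)
  conjugate? c x = G.any?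
    (λ h≈k (h∈H , eq) → resp h≈k h∈H , G.trans eq (G.∙-congʳ (G.∙-congˡ h≈k)))
    (λ h → member? h ×-dec (x G.≈? (c G.∙ h G.∙ c G.⁻¹)))

  conjugate-resp : ∀ c → Conjugate c Respects G._≈_
  conjugate-resp c x≈y (h , h∈H , eq) = h , h∈H , G.trans (G.sym x≈y) eq

  normalizer? : Decidable Normalizer
  normalizer? c =
    G.all? (λ x≈y f → resp x≈y ∘ f ∘ conjugate-resp c (G.sym x≈y))
           (λ x → conjugate? c x →-dec member? x)
    ×-dec
    G.all? (λ x≈y f → conjugate-resp c x≈y ∘ f ∘ resp (G.sym x≈y))
           (λ x → member? x →-dec conjugate? c x)

Signs : Setoid 0ℓ 0ℓ
Signs = ≡.setoid Sign

signToℤ : Sign → ℤ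
signToℤ s = s ◃ 1

-- The raw group is taken from *-group because the inverse in *-1-rawGroup is
-- `opposite`, which is not the group inverse.

record NontrivialCharacter {c ℓ : Level} (K : Group c ℓ) : Set (c ⊔ ℓ) where
  private module K = Group K
  field
    φ              : K.Carrier → Sign
    isHomomorphism : IsGroupHomomorphism K.rawGroup (Group.rawGroup Sign.*-group) φ
    nontrivial     : ¬ (∀ h → φ h ≡ Sign.+)

module _ {c ℓ : Level} (G : FiniteGroup c ℓ) where
  open FiniteGroup G

  Multiplicative : (setoid ⟶ₛ Signs) → Pred (Carrier × Carrier) 0ℓ
  Multiplicative f (x , y) = (f ⟨$⟩ x) Sign.* (f ⟨$⟩ y) ≡ f ⟨$⟩ (x ∙ y)

  multiplicative? : ∀ f → Decidable (Multiplicative f)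
  multiplicative? f (x , y) = ((f ⟨$⟩ x) Sign.* (f ⟨$⟩ y)) Sign.≟ (f ⟨$⟩ (x ∙ y))

{-# OPTIONS --safe #-}
module Submission where

-- Choose representatives r of the left cosets of H and put f (r h) = v (r) φ (h) for a choice
-- v of signs, normalised so that f = φ on H.  Every such f sums to 0 over each coset.  Averaging
-- f(x) f(y) f(xy) over all v leaves only:
--   • y ∈ H, where the product is 1;
--   • x ∈ H ∩ y H y⁻¹ with y ∉ H, where the product is φ(x) φ(y⁻¹xy); for fixed y this is a
--     character of the subgroup H ∩ y H y⁻¹, so its sum over x is nonnegative;
--   • x ∈ y H ∩ H y⁻¹ with y ∉ H, where the product is at least -1.  The number of these x is
--     at most |H|, and at most |H| / 2 when y does not normalise H: for h ∈ H with
--     y h y⁻¹ ∉ H (or y⁻¹ h y ∉ H), multiplication by y h y⁻¹ on the left (or by h on the right)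
--     moves these x to other elements of y H.
-- Hence some v gives Σ f(x) f(y) f(xy) ≥ |H||G| - |H|(|N(H)| - |H|) - |H|(|G| - |N(H)|) / 2.

open import Defs
import Algebra.Properties.CommutativeSemigroup as CommutativeSemigroupProperties
import Algebra.Properties.Group as GroupProperties
open import Algebra.Morphism.Structures using (IsGroupHomomorphism)
open import Data.Empty using (⊥-elim)
open import Data.Fin.Base using (Fin; zero; suc)
open import Data.Fin.Permutation using (permutation)
import Data.Fin.Properties as Fin
open import Data.Integer.Base as ℤ using (ℤ; +_; -[1+_]; +[1+_]; 0ℤ; 1ℤ; -1ℤ)
import Data.Integer.Properties as ℤ
open import Data.Integer.Solver using (module +-*-Solver)
open import Data.List.Base using (length; filter; tabulate; cartesianProduct; map; foldr; _++_)
import Data.List.Properties as List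
open import Data.Nat.Base as ℕ using (ℕ; zero; suc)
open import Data.Product.Base using (Σ; ∃; _×_; _,_; proj₁; proj₂)
open import Data.Rational.Base using (_/_; _+_; _*_; _-_; -_; _≥_; 0ℚ; 1ℚ; ½; toℚᵘ)
import Data.Rational.Properties as ℚ
import Data.Rational.Unnormalised.Base as ℚᵘ
import Data.Rational.Unnormalised.Properties as ℚᵘ
open import Data.Sign.Base as Sign using (Sign; opposite)
import Data.Sign.Properties as Sign
open import Data.Vec.Base using (Vec; []; _∷_; updateAt; lookup)
import Data.Vec.Properties as Vec
open import Function.Base using (_∘_)
open import Function.Bundles using (Inverse; _⟶ₛ_; _⟨$⟩_)
open import Level using (Level)
open import Relation.Binary.PropositionalEquality as ≡ using (_≡_; cong; cong₂; subst; module ≡-Reasoning)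
import Relation.Binary.Reasoning.Setoid as SetoidReasoning
open import Relation.Nullary.Decidable using (Dec; yes; no; _×-dec_; ¬?; decidable-stable)
open import Relation.Nullary.Negation using (¬_; contradiction)
open import Relation.Unary using (Pred; Decidable; _∈_; _∉_)
open import Algebra.Properties.CommutativeMonoid.Sum ℤ.+-0-commutativeMonoid
  using (sum; sum-cong-≗; sum-permute; ∑-comm; ∑-distrib-+; sum-replicate-zero)

-- Integer sums, indicators and cardinalities.

i≡-i⇒i≡0 : ∀ {i} → i ≡ ℤ.- i → i ≡ 0ℤ
i≡-i⇒i≡0 {+ zero}   _ = ≡.refl
i≡-i⇒i≡0 {+[1+ _ ]} ()
i≡-i⇒i≡0 { -[1+ _ ]} ()

sum-mono : ∀ {n} {f g : Fin n → ℤ} → (∀ i → f i ℤ.≤ g i) → sum f ℤ.≤ sum g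
sum-mono {zero}  f≤g = ℤ.≤-refl
sum-mono {suc n} f≤g = ℤ.+-mono-≤ (f≤g zero) (sum-mono (f≤g ∘ suc))

sum-neg : ∀ {n} (f : Fin n → ℤ) → sum (λ i → ℤ.- f i) ≡ ℤ.- sum f
sum-neg {zero}  f = ≡.refl
sum-neg {suc n} f = ≡.trans (cong (λ s → ℤ.- f zero ℤ.+ s) (sum-neg (f ∘ suc)))
  (≡.sym (ℤ.neg-distrib-+ (f zero) (sum (f ∘ suc))))

sum-*ˡ : ∀ {n} k (f : Fin n → ℤ) → sum (λ i → k ℤ.* f i) ≡ k ℤ.* sum f
sum-*ˡ {zero}  k f = ≡.sym (ℤ.*-zeroʳ k)
sum-*ˡ {suc n} k f = ≡.trans (cong (λ s → k ℤ.* f zero ℤ.+ s) (sum-*ˡ k (f ∘ suc)))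
  (≡.sym (ℤ.*-distribˡ-+ k (f zero) (sum (f ∘ suc))))

sum-const : ∀ n k → sum {n} (λ _ → k) ≡ + n ℤ.* k
sum-const zero    k = ≡.refl
sum-const (suc n) k = ≡.trans (cong (λ s → k ℤ.+ s) (sum-const n k)) (≡.sym (ℤ.suc-* (+ n) k))

foldr-tabulate : ∀ {a} {A : Set a} {n} (f : A → ℤ) (e : Fin n → A) →
                 foldr ℤ._+_ 0ℤ (map f (tabulate e)) ≡ sum (f ∘ e)
foldr-tabulate {n = zero}  f e = ≡.refl
foldr-tabulate {n = suc n} f e = cong (λ s → f (e zero) ℤ.+ s) (foldr-tabulate f (e ∘ suc))

𝟙 : ∀ {p} {P : Set p} → Dec P → ℤ
𝟙 (yes _) = 1ℤ
𝟙 (no _)  = 0ℤ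

𝟙-yes : ∀ {p} {P : Set p} (P? : Dec P) → P → 𝟙 P? ≡ 1ℤ
𝟙-yes (yes _) _ = ≡.refl
𝟙-yes (no ¬p) p = contradiction p ¬p

𝟙-no : ∀ {p} {P : Set p} (P? : Dec P) → ¬ P → 𝟙 P? ≡ 0ℤ
𝟙-no (yes p) ¬p = contradiction p ¬p
𝟙-no (no _)  _  = ≡.refl

𝟙-⇔ : ∀ {p q} {P : Set p} {Q : Set q} (P? : Dec P) (Q? : Dec Q) →
      (P → Q) → (Q → P) → 𝟙 P? ≡ 𝟙 Q?
𝟙-⇔ (yes p) Q? P→Q _   = ≡.sym (𝟙-yes Q? (P→Q p))
𝟙-⇔ (no ¬p) Q? _   Q→P = ≡.sym (𝟙-no Q? (¬p ∘ Q→P))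

0≤𝟙 : ∀ {p} {P : Set p} (P? : Dec P) → 0ℤ ℤ.≤ 𝟙 P?
0≤𝟙 (yes _) = ℤ.+≤+ ℕ.z≤n
0≤𝟙 (no _)  = ℤ.≤-refl

𝟙≤1 : ∀ {p} {P : Set p} (P? : Dec P) → 𝟙 P? ℤ.≤ 1ℤ
𝟙≤1 (yes _) = ℤ.≤-refl
𝟙≤1 (no _)  = ℤ.+≤+ ℕ.z≤n

length-filter-tabulate : ∀ {a p} {A : Set a} {P : Pred A p} (P? : Decidable P) {n} (e : Fin n → A) →
                         + length (filter P? (tabulate e)) ≡ sum (λ i → 𝟙 (P? (e i)))
length-filter-tabulate P? {zero}  e = ≡.refl
length-filter-tabulate P? {suc n} e with P? (e zero)
... | yes _ = cong ℤ.suc (length-filter-tabulate P? (e ∘ suc))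
... | no _  = ≡.trans (length-filter-tabulate P? (e ∘ suc)) (≡.sym (ℤ.+-identityˡ _))

length-filter-cartesianProduct :
  ∀ {a b p} {A : Set a} {B : Set b} {P : Pred (A × B) p} (P? : Decidable P)
  {m n} (d : Fin m → A) (e : Fin n → B) →
  + length (filter P? (cartesianProduct (tabulate d) (tabulate e)))
    ≡ sum (λ i → sum (λ j → 𝟙 (P? (d i , e j))))
length-filter-cartesianProduct P? {zero}  d e = ≡.refl
length-filter-cartesianProduct P? {suc m} d e = begin
  + length (filter P? (row ++ rest))
    ≡⟨ cong (+_ ∘ length) (List.filter-++ P? row rest) ⟩
  + length (filter P? row ++ filter P? rest)
    ≡⟨ cong +_ (List.length-++ (filter P? row)) ⟩
  + length (filter P? row) ℤ.+ + length (filter P? rest)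
    ≡⟨ cong₂ ℤ._+_
         (≡.trans (cong (+_ ∘ length ∘ filter P?) (List.map-tabulate e (d zero ,_)))
                (length-filter-tabulate P? (λ j → d zero , e j)))
         (length-filter-cartesianProduct P? (d ∘ suc) e) ⟩
  sum (λ j → 𝟙 (P? (d zero , e j))) ℤ.+ _ ∎
  where
  open ≡-Reasoning
  row  = map (d zero ,_) (tabulate e)
  rest = cartesianProduct (tabulate (d ∘ suc)) (tabulate e)

-- Arithmetic of signs.

opposite-*ˡ : ∀ s t → opposite s Sign.* t ≡ opposite (s Sign.* t)
opposite-*ˡ Sign.+ t = ≡.refl
opposite-*ˡ Sign.- t = ≡.sym (Sign.opposite-involutive t)

opposite-*ʳ : ∀ s t → s Sign.* opposite t ≡ opposite (s Sign.* t)
opposite-*ʳ Sign.+ t = ≡.refl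
opposite-*ʳ Sign.- t = ≡.refl

signToℤ-opposite : ∀ s → signToℤ (opposite s) ≡ ℤ.- signToℤ s
signToℤ-opposite Sign.+ = ≡.refl
signToℤ-opposite Sign.- = ≡.refl

-1≤signToℤ : ∀ s → -1ℤ ℤ.≤ signToℤ s
-1≤signToℤ Sign.+ = ℤ.-≤+
-1≤signToℤ Sign.- = ℤ.≤-refl

signToℤ-≟ : ∀ s t → signToℤ (s Sign.* t) ≡ + 2 ℤ.* 𝟙 (s Sign.≟ t) ℤ.+ -1ℤ
signToℤ-≟ Sign.+ Sign.+ = ≡.refl
signToℤ-≟ Sign.+ Sign.- = ≡.refl
signToℤ-≟ Sign.- Sign.+ = ≡.refl
signToℤ-≟ Sign.- Sign.- = ≡.refl

-- Averaging over all sign vectors.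

-- A sum stands in for the average, which keeps everything in ℤ. A bound c on the average is
-- expressed by comparison with the sum of the constant c, without powers of 2.
sumSigns : ∀ {n} → (Vec Sign n → ℤ) → ℤ
sumSigns {zero}  F = F []
sumSigns {suc n} F = sumSigns (λ v → F (Sign.+ ∷ v)) ℤ.+ sumSigns (λ v → F (Sign.- ∷ v))

sumSigns-mono : ∀ {n} {F G : Vec Sign n → ℤ} → (∀ v → F v ℤ.≤ G v) → sumSigns F ℤ.≤ sumSigns G
sumSigns-mono {zero}  F≤G = F≤G []
sumSigns-mono {suc n} F≤G =
  ℤ.+-mono-≤ (sumSigns-mono (λ v → F≤G (_ ∷ v))) (sumSigns-mono (λ v → F≤G (_ ∷ v)))

sumSigns-cong : ∀ {n} {F G : Vec Sign n → ℤ} → (∀ v → F v ≡ G v) → sumSigns F ≡ sumSigns G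
sumSigns-cong {zero}  F≡G = F≡G []
sumSigns-cong {suc n} F≡G =
  cong₂ ℤ._+_ (sumSigns-cong (λ v → F≡G (_ ∷ v))) (sumSigns-cong (λ v → F≡G (_ ∷ v)))

sumSigns-0 : ∀ n → sumSigns {n} (λ _ → 0ℤ) ≡ 0ℤ
sumSigns-0 zero    = ≡.refl
sumSigns-0 (suc n) = cong₂ ℤ._+_ (sumSigns-0 n) (sumSigns-0 n)

sumSigns-+ : ∀ {n} (F G : Vec Sign n → ℤ) → sumSigns (λ v → F v ℤ.+ G v) ≡ sumSigns F ℤ.+ sumSigns G
sumSigns-+ {zero}  F G = ≡.refl
sumSigns-+ {suc n} F G = ≡.trans
  (cong₂ ℤ._+_ (sumSigns-+ (λ v → F (_ ∷ v)) (λ v → G (_ ∷ v)))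
               (sumSigns-+ (λ v → F (_ ∷ v)) (λ v → G (_ ∷ v))))
  (solve 4 (λ a b c d → (a :+ b) :+ (c :+ d) := (a :+ c) :+ (b :+ d)) ≡.refl
    (sumSigns (λ v → F (Sign.+ ∷ v))) _ (sumSigns (λ v → F (Sign.- ∷ v))) _)
  where open +-*-Solver

sumSigns-sum : ∀ {n m} (F : Fin m → Vec Sign n → ℤ) →
               sumSigns (λ v → sum (λ i → F i v)) ≡ sum (λ i → sumSigns (F i))
sumSigns-sum {n} {zero}  F = sumSigns-0 n
sumSigns-sum {n} {suc m} F = ≡.trans (sumSigns-+ (F zero) _)
  (cong (λ s → sumSigns (F zero) ℤ.+ s) (sumSigns-sum (F ∘ suc)))

-- Flipping coordinate i pairs off the sign vectors, and the two terms of each pair cancel.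
sumSigns-odd : ∀ {n} (F : Vec Sign n → ℤ) i → (∀ v → F (updateAt v i opposite) ≡ ℤ.- F v) →
               sumSigns F ≡ 0ℤ
sumSigns-odd {suc n} F zero odd = begin
  sumSigns F₊ ℤ.+ sumSigns F₋         ≡⟨ sumSigns-+ F₊ F₋ ⟨
  sumSigns (λ v → F₊ v ℤ.+ F₋ v)
    ≡⟨ sumSigns-cong (λ v → ≡.trans (cong (λ z → F₊ v ℤ.+ z) (odd (Sign.+ ∷ v))) (ℤ.+-inverseʳ (F₊ v))) ⟩
  sumSigns {n} (λ _ → 0ℤ)             ≡⟨ sumSigns-0 n ⟩
  0ℤ                                  ∎
  where
  open ≡-Reasoning
  F₊ F₋ : Vec Sign n → ℤ
  F₊ v = F (Sign.+ ∷ v)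
  F₋ v = F (Sign.- ∷ v)
sumSigns-odd {suc n} F (suc i) odd =
  cong₂ ℤ._+_ (sumSigns-odd _ i (λ v → odd (_ ∷ v))) (sumSigns-odd _ i (λ v → odd (_ ∷ v)))

-- Some value is at least the average. The vector is found coordinate by coordinate: if both halves
-- fell below the corresponding sum of c, so would the total.
sumSigns-∃ : ∀ {n} c (F : Vec Sign n → ℤ) → sumSigns {n} (λ _ → c) ℤ.≤ sumSigns F → ∃ λ v → c ℤ.≤ F v
sumSigns-∃ {zero}  c F le = [] , le
sumSigns-∃ {suc n} c F le with sumSigns {n} (λ _ → c) ℤ.≤? sumSigns (λ v → F (Sign.+ ∷ v))
... | yes le₊ = let v , c≤ = sumSigns-∃ c _ le₊ in Sign.+ ∷ v , c≤
... | no  ≰₊ with sumSigns {n} (λ _ → c) ℤ.≤? sumSigns (λ v → F (Sign.- ∷ v))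
...   | yes le₋ = let v , c≤ = sumSigns-∃ c _ le₋ in Sign.- ∷ v , c≤
...   | no  ≰₋  = contradiction (ℤ.≤-<-trans le (ℤ.+-mono-< (ℤ.≰⇒> ≰₊) (ℤ.≰⇒> ≰₋))) (ℤ.<-irrefl ≡.refl)

-- Least index satisfying a decidable predicate.

least : ∀ {n p} {P : Pred (Fin n) p} → Decidable P → ∃ P → Fin n
least {suc n} P? (i , Pi) with P? zero
... | yes _ = zero
least {suc n} P? (zero  , Pi) | no ¬P0 = contradiction Pi ¬P0
least {suc n} P? (suc i , Pi) | no ¬P0 = suc (least (P? ∘ suc) (i , Pi))

least-satisfies : ∀ {n p} {P : Pred (Fin n) p} (P? : Decidable P) (∃P : ∃ P) → P (least P? ∃P)
least-satisfies {suc n} P? (i , Pi) with P? zero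
... | yes P0 = P0
least-satisfies {suc n} P? (zero  , Pi) | no ¬P0 = contradiction Pi ¬P0
least-satisfies {suc n} P? (suc i , Pi) | no ¬P0 = least-satisfies (P? ∘ suc) (i , Pi)

-- The least index depends only on the extension of the predicate, not on the witness or the
-- decision procedure. This makes coset representatives canonical.
least-cong : ∀ {n p q} {P : Pred (Fin n) p} {Q : Pred (Fin n) q} (P? : Decidable P) (Q? : Decidable Q)
             (∃P : ∃ P) (∃Q : ∃ Q) → (∀ {i} → P i → Q i) → (∀ {i} → Q i → P i) → least P? ∃P ≡ least Q? ∃Q
least-cong {suc n} P? Q? (i , Pi) (j , Qj) P⊆Q Q⊆P with P? zero | Q? zero
... | yes _  | yes _  = ≡.refl
... | yes P0 | no ¬Q0 = contradiction (P⊆Q P0) ¬Q0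
... | no ¬P0 | yes Q0 = contradiction (Q⊆P Q0) ¬P0
least-cong P? Q? (zero  , Pi) _           _ _ | no ¬P0 | no _ = contradiction Pi ¬P0
least-cong P? Q? (suc _ , _) (zero  , Qj) _ _ | no _ | no ¬Q0 = contradiction Qj ¬Q0
least-cong P? Q? (suc i , Pi) (suc j , Qj) P⊆Q Q⊆P | no _ | no _ =
  cong suc (least-cong (P? ∘ suc) (Q? ∘ suc) (i , Pi) (j , Qj) P⊆Q Q⊆P)

-- From an integer inequality to the rational bound.

-- The numerators and the denominators Dᵢ are written as ℚᵘ arithmetic computes them, hence the factors 1.
cross-multiplied : ∀ N H K P {N² H² D₁ D₂ D₃} .{{_ : ℤ.NonNegative (N ℤ.* N ℤ.* (N ℤ.* N))}} →
  N² ≡ N ℤ.* N → H² ≡ H ℤ.* H →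
  D₁ ≡ + 2 ℤ.* N ℤ.* (1ℤ ℤ.* N) → D₂ ≡ 1ℤ ℤ.* D₁ → D₃ ≡ + 2 ℤ.* (D₂ ℤ.* N²) →
  + 2 ℤ.* (N ℤ.* N) ℤ.+ (N ℤ.* H ℤ.+ + 2 ℤ.* (H ℤ.* H) ℤ.- H ℤ.* K) ℤ.≤ + 4 ℤ.* P →
  1ℤ ℤ.* ((1ℤ ℤ.* D₁ ℤ.+ 1ℤ ℤ.* H ℤ.* (1ℤ ℤ.* N ℤ.+ ℤ.- K ℤ.* 1ℤ) ℤ.* 1ℤ) ℤ.* N² ℤ.+ H² ℤ.* D₂) ℤ.* N²
    ℤ.≤ P ℤ.* D₃
cross-multiplied N H K P ≡.refl ≡.refl ≡.refl ≡.refl ≡.refl le = begin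
  _ ≡⟨ solve 3 (λ N H K →
         con 1ℤ :* ((con 1ℤ :* (con (+ 2) :* N :* (con 1ℤ :* N))
           :+ con 1ℤ :* H :* (con 1ℤ :* N :+ :- K :* con 1ℤ) :* con 1ℤ) :* (N :* N)
           :+ H :* H :* (con 1ℤ :* (con (+ 2) :* N :* (con 1ℤ :* N)))) :* (N :* N)
         := N :* N :* (N :* N) :* (con (+ 2) :* (N :* N) :+ (N :* H :+ con (+ 2) :* (H :* H) :- H :* K)))
         ≡.refl N H K ⟩
  N⁴ ℤ.* _             ≤⟨ ℤ.*-monoˡ-≤-nonNeg N⁴ le ⟩
  N⁴ ℤ.* (+ 4 ℤ.* P)
    ≡⟨ solve 2 (λ N P → N :* N :* (N :* N) :* (con (+ 4) :* P)
         := P :* (con (+ 2) :* (con 1ℤ :* (con (+ 2) :* N :* (con 1ℤ :* N)) :* (N :* N)))) ≡.refl N P ⟩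
  _ ∎
  where
  open ℤ.≤-Reasoning
  open +-*-Solver
  N⁴ = N ℤ.* N ℤ.* (N ℤ.* N)

-- Elements of ℚ are kept in lowest terms. Among unnormalised fractions the bound has an explicit
-- numerator and denominator, so it can be cross-multiplied.
toℚᵘ-bound : ∀ p q r {p′ q′ r′} → toℚᵘ p ℚᵘ.≃ p′ → toℚᵘ q ℚᵘ.≃ q′ → toℚᵘ r ℚᵘ.≃ r′ →
  toℚᵘ (½ * (1ℚ + ½ * p * (1ℚ - q) + r))
    ℚᵘ.≃ ℚᵘ.½ ℚᵘ.* (ℚᵘ.1ℚᵘ ℚᵘ.+ ℚᵘ.½ ℚᵘ.* p′ ℚᵘ.* (ℚᵘ.1ℚᵘ ℚᵘ.- q′) ℚᵘ.+ r′)
toℚᵘ-bound p q r p≃ q≃ r≃ = *-homo ½ (1ℚ + ½ * p * (1ℚ - q) + r) ℚᵘ.≃-refl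
  (+-homo (1ℚ + ½ * p * (1ℚ - q)) r
    (+-homo 1ℚ (½ * p * (1ℚ - q)) ℚᵘ.≃-refl
      (*-homo (½ * p) (1ℚ - q) (*-homo ½ p ℚᵘ.≃-refl p≃)
        (+-homo 1ℚ (- q) ℚᵘ.≃-refl (ℚᵘ.≃-trans (ℚ.toℚᵘ-homo‿- q) (ℚᵘ.-‿cong q≃)))))
    r≃)
  where
  *-homo : ∀ x y {x′ y′} → toℚᵘ x ℚᵘ.≃ x′ → toℚᵘ y ℚᵘ.≃ y′ → toℚᵘ (x * y) ℚᵘ.≃ x′ ℚᵘ.* y′
  *-homo x y x≃ y≃ = ℚᵘ.≃-trans (ℚ.toℚᵘ-homo-* x y) (ℚᵘ.*-cong x≃ y≃)
  +-homo : ∀ x y {x′ y′} → toℚᵘ x ℚᵘ.≃ x′ → toℚᵘ y ℚᵘ.≃ y′ → toℚᵘ (x + y) ℚᵘ.≃ x′ ℚᵘ.+ y′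
  +-homo x y x≃ y≃ = ℚᵘ.≃-trans (ℚ.toℚᵘ-homo-+ x y) (ℚᵘ.+-cong x≃ y≃)

-- The integer hypothesis is the rational bound multiplied by 4n².
ratio-bound : ∀ n .{{_ : ℕ.NonZero n}} .{{_ : ℕ.NonZero (n ℕ.* n)}} (P h k : ℕ) →
  + 2 ℤ.* (+ n ℤ.* + n) ℤ.+ (+ n ℤ.* + h ℤ.+ + 2 ℤ.* (+ h ℤ.* + h) ℤ.- + h ℤ.* + k)
    ℤ.≤ + 4 ℤ.* + P →
  + P / (n ℕ.* n) ≥ ½ * (1ℚ + ½ * (+ h / n) * (1ℚ - + k / n) + + (h ℕ.* h) / (n ℕ.* n))
-- With n exposed as a successor, `+ h / n` is `fromℚᵘ` of the unreduced fraction `u h`.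
ratio-bound n@(suc m) P h k le = ℚ.toℚᵘ-cancel-≤ (begin
  toℚᵘ (½ * (1ℚ + ½ * (+ h / n) * (1ℚ - + k / n) + + (h ℕ.* h) / (n ℕ.* n)))
    ≃⟨ toℚᵘ-bound (+ h / n) (+ k / n) (+ (h ℕ.* h) / (n ℕ.* n))
         (ℚ.toℚᵘ-fromℚᵘ (u h)) (ℚ.toℚᵘ-fromℚᵘ (u k)) (ℚ.toℚᵘ-fromℚᵘ v) ⟩
  rhs
    ≤⟨ ℚᵘ.*≤* le′ ⟩
  ℚᵘ.mkℚᵘ (+ P) (ℕ.pred (n ℕ.* n))
    ≃⟨ ℚ.toℚᵘ-fromℚᵘ (ℚᵘ.mkℚᵘ (+ P) (ℕ.pred (n ℕ.* n))) ⟨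
  toℚᵘ (+ P / (n ℕ.* n)) ∎)
  where
  open ℚᵘ.≤-Reasoning
  u : ℕ → ℚᵘ.ℚᵘ
  u a = ℚᵘ.mkℚᵘ (+ a) m
  v = ℚᵘ.mkℚᵘ (+ (h ℕ.* h)) (ℕ.pred (n ℕ.* n))
  rhs = ℚᵘ.½ ℚᵘ.* (ℚᵘ.1ℚᵘ ℚᵘ.+ ℚᵘ.½ ℚᵘ.* u h ℚᵘ.* (ℚᵘ.1ℚᵘ ℚᵘ.- u k) ℚᵘ.+ v)
  le′ : ℚᵘ.↥ rhs ℤ.* ℚᵘ.↧ (ℚᵘ.mkℚᵘ (+ P) (ℕ.pred (n ℕ.* n))) ℤ.≤ + P ℤ.* ℚᵘ.↧ rhs
  le′ = cross-multiplied (+ n) (+ h) (+ k) (+ P) (ℤ.pos-* n n) (ℤ.pos-* h h)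
    (≡.trans (ℤ.pos-* (2 ℕ.* n) (1 ℕ.* n)) (cong₂ ℤ._*_ (ℤ.pos-* 2 n) (ℤ.pos-* 1 n)))
    (ℤ.pos-* 1 (2 ℕ.* n ℕ.* (1 ℕ.* n)))
    (≡.trans (ℤ.pos-* 2 d) (cong (+ 2 ℤ.*_) (ℤ.pos-* (1 ℕ.* (2 ℕ.* n ℕ.* (1 ℕ.* n))) (n ℕ.* n)))) le
    where d = 1 ℕ.* (2 ℕ.* n ℕ.* (1 ℕ.* n)) ℕ.* (n ℕ.* n)

-- Sums over a finite group and their invariance under translation.

module FiniteGroupSums {c ℓ : Level} (G : FiniteGroup c ℓ) where
  open FiniteGroup G
  open GroupProperties group

  Congruent : (Carrier → ℤ) → Set _
  Congruent F = ∀ {x y} → x ≈ y → F x ≡ F y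

  ∑ : (Carrier → ℤ) → ℤ
  ∑ F = sum (F ∘ element)

  ∑-bijection : ∀ {F} → Congruent F → (σ τ : Carrier → Carrier) →
                (∀ {x y} → x ≈ y → σ x ≈ σ y) → (∀ {x y} → x ≈ y → τ x ≈ τ y) →
                (∀ x → σ (τ x) ≈ x) → (∀ x → τ (σ x) ≈ x) → ∑ (F ∘ σ) ≡ ∑ F
  ∑-bijection {F} F-cong σ τ σ-cong τ-cong στ τσ = ≡.trans
    (sum-cong-≗ (λ i → F-cong (sym (element-index (σ (element i))))))
    (≡.sym (sum-permute (F ∘ element)
      (permutation (onIndex σ) (onIndex τ) (cancel σ τ σ-cong στ) (cancel τ σ τ-cong τσ))))
    where
    onIndex : (Carrier → Carrier) → Fin order → Fin order
    onIndex ρ i = index (ρ (element i))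
    cancel : ∀ ρ π → (∀ {x y} → x ≈ y → ρ x ≈ ρ y) → (∀ x → ρ (π x) ≈ x) →
             ∀ i → onIndex ρ (onIndex π i) ≡ i
    cancel ρ π ρ-cong ρπ i = ≡.trans (index-cong (trans (ρ-cong (element-index _)) (ρπ _)))
      (Inverse.inverseˡ enumeration refl)

  ∑-shiftˡ : ∀ {F} → Congruent F → ∀ g → ∑ (λ x → F (g ∙ x)) ≡ ∑ F
  ∑-shiftˡ F-cong g = ∑-bijection F-cong (g ∙_) (g ⁻¹ ∙_) ∙-congˡ ∙-congˡ
    (\\-leftDividesˡ g) (\\-leftDividesʳ g)

  ∑-shiftʳ : ∀ {F} → Congruent F → ∀ g → ∑ (λ x → F (x ∙ g)) ≡ ∑ F
  ∑-shiftʳ F-cong g = ∑-bijection F-cong (_∙ g) (_∙ g ⁻¹) ∙-congʳ ∙-congʳ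
    (//-rightDividesˡ g) (//-rightDividesʳ g)

  -- The sum equals its own negative. It is applied to translations by an element on which a
  -- character is negative.
  ∑-odd : ∀ {F} (σ : Carrier → Carrier) → ∑ (F ∘ σ) ≡ ∑ F → (∀ x → F (σ x) ≡ ℤ.- F x) → ∑ F ≡ 0ℤ
  ∑-odd {F} σ inv odd = i≡-i⇒i≡0 (≡.trans (≡.sym inv)
    (≡.trans (sum-cong-≗ (λ i → odd (element i))) (sum-neg (F ∘ element))))

-- The character as a function on the whole group.

module Character {c ℓ p : Level} (G : FiniteGroup c ℓ) (H : Subgroup G p)
                 (χ : NontrivialCharacter (Subgroup.group H)) where
  open FiniteGroup G
  open Subgroup H hiding (group)
  open NontrivialCharacter χ renaming (φ to φᴴ)
  open IsGroupHomomorphism isHomomorphism using (homo; ⟦⟧-cong)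
  open GroupProperties group
  open FiniteGroupSums G

  -- A total extension of `φᴴ`, so that signs can be written without membership proofs; `Sign.+`
  -- outside H is a default value.
  φ : Carrier → Sign
  φ x with member? x
  ... | yes x∈H = φᴴ (x , x∈H)
  ... | no  _   = Sign.+

  φ-member : ∀ {x} (x∈H : x ∈ Member) → φ x ≡ φᴴ (x , x∈H)
  φ-member {x} x∈H with member? x
  ... | yes _  = ⟦⟧-cong refl
  ... | no x∉H = contradiction x∈H x∉H

  φ-cong : ∀ {x y} → x ≈ y → φ x ≡ φ y
  φ-cong {x} {y} x≈y with member? x | member? y
  ... | yes _   | yes _   = ⟦⟧-cong x≈y
  ... | yes x∈H | no y∉H  = contradiction (resp x≈y x∈H) y∉H
  ... | no x∉H  | yes y∈H = contradiction (resp (sym x≈y) y∈H) x∉H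
  ... | no _    | no _    = ≡.refl

  φ-∙ : ∀ {x y} → x ∈ Member → y ∈ Member → φ (x ∙ y) ≡ φ x Sign.* φ y
  φ-∙ x∈H y∈H = ≡.trans (φ-member (∙-closed x∈H y∈H)) (≡.trans (homo (_ , x∈H) (_ , y∈H))
    (≡.sym (cong₂ Sign._*_ (φ-member x∈H) (φ-member y∈H))))

  -- Nontriviality is given as a negation; a search through the finite group turns it into a
  -- witness.
  φ-nontrivial : ∃ λ h → h ∈ Member × φ h ≡ Sign.-
  φ-nontrivial with any? (λ x≈y (x∈H , eq) → resp x≈y x∈H , ≡.trans (φ-cong (sym x≈y)) eq)
                         (λ x → member? x ×-dec (φ x Sign.≟ Sign.-))
  ... | yes found = found
  ... | no none   = contradiction trivial nontrivial
    where
    trivial : ∀ h → φᴴ h ≡ Sign.+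
    trivial (x , x∈H) with φᴴ (x , x∈H) in eq
    ... | Sign.+ = ≡.refl
    ... | Sign.- = contradiction (x , x∈H , ≡.trans (φ-member x∈H) eq) none

  -- Left cosets, their representatives and equivariant functions.

  infix 4 _~_ _~?_
  -- Equality of the left cosets xH and yH.
  _~_ : Carrier → Carrier → Set p
  x ~ y = x ⁻¹ ∙ y ∈ Member

  _~?_ : ∀ x y → Dec (x ~ y)
  x ~? y = member? (x ⁻¹ ∙ y)

  ~-reflexive : ∀ {x y} → x ≈ y → x ~ y
  ~-reflexive {x} x≈y = resp (trans (sym (inverseˡ x)) (∙-congˡ x≈y)) ε-closed

  ~-sym : ∀ {x y} → x ~ y → y ~ x
  ~-sym {x} {y} x~y = resp (trans (⁻¹-anti-homo-∙ (x ⁻¹) y) (∙-congˡ (⁻¹-involutive x))) (⁻¹-closed x~y)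

  ~-trans : ∀ {x y z} → x ~ y → y ~ z → x ~ z
  ~-trans {x} {y} {z} x~y y~z = resp (trans (assoc _ _ _) (∙-congˡ (\\-leftDividesˡ y z))) (∙-closed x~y y~z)

  ~-∙ : ∀ {x h} → h ∈ Member → x ~ x ∙ h
  ~-∙ {x} {h} h∈H = resp (sym (\\-leftDividesʳ x h)) h∈H

  ε~⇒∈ : ∀ {x} → ε ~ x → x ∈ Member
  ε~⇒∈ {x} = resp (trans (∙-congʳ ε⁻¹≈ε) (identityˡ x))

  ∈⇒ε~ : ∀ {x} → x ∈ Member → ε ~ x
  ∈⇒ε~ {x} = resp (sym (trans (∙-congʳ ε⁻¹≈ε) (identityˡ x)))

  ∈-∙ˡ⁻ : ∀ {x y} → x ∈ Member → x ∙ y ∈ Member → y ∈ Member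
  ∈-∙ˡ⁻ {x} {y} x∈H xy∈H = resp (\\-leftDividesʳ x y) (∙-closed (⁻¹-closed x∈H) xy∈H)

  ∈-∙ʳ⁻ : ∀ {x y} → y ∈ Member → x ∙ y ∈ Member → x ∈ Member
  ∈-∙ʳ⁻ {x} {y} y∈H xy∈H = resp (//-rightDividesʳ y x) (∙-closed xy∈H (⁻¹-closed y∈H))

  coset : ∀ x → ∃ λ i → element i ~ x
  coset x = index x , ~-reflexive (element-index x)

  -- The least index in the coset is the same for all its elements, so it can also index the sign
  -- attached to that coset.
  rep : Carrier → Fin order
  rep x = least (λ i → element i ~? x) (coset x)

  rep~ : ∀ x → element (rep x) ~ x
  rep~ x = least-satisfies (λ i → element i ~? x) (coset x)

  rep-cong : ∀ {x y} → x ~ y → rep x ≡ rep y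
  rep-cong x~y = least-cong _ _ _ _ (λ i~x → ~-trans i~x x~y) (λ i~y → ~-trans i~y (~-sym x~y))

  rep-injective : ∀ {x y} → rep x ≡ rep y → x ~ y
  rep-injective {x} {y} eq = ~-trans (~-sym (rep~ x)) (subst (λ i → element i ~ y) (≡.sym eq) (rep~ y))

  -- A choice of signs v for the left cosets extends φ to an H-equivariant function f v on G;
  -- g v is f v normalised to be + at ε, so that it restricts to φ on H.
  f g : Vec Sign order → Carrier → Sign
  f v x = lookup v (rep x) Sign.* φ (element (rep x) ⁻¹ ∙ x)
  g v x = f v ε Sign.* f v x

  f-cong : ∀ v {x y} → x ≈ y → f v x ≡ f v y
  f-cong v {x} {y} x≈y rewrite rep-cong (~-reflexive x≈y) = cong (λ s → lookup v (rep y) Sign.* s) (φ-cong (∙-congˡ x≈y))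

  f-∙ : ∀ v x {h} → h ∈ Member → f v (x ∙ h) ≡ f v x Sign.* φ h
  f-∙ v x {h} h∈H rewrite ≡.sym (rep-cong (~-∙ {x} h∈H)) = ≡.trans
    (cong (λ s → lookup v (rep x) Sign.* s) (≡.trans (φ-cong (sym (assoc _ x h))) (φ-∙ (rep~ x) h∈H)))
    (≡.sym (Sign.*-assoc (lookup v (rep x)) _ _))

  g-cong : ∀ v {x y} → x ≈ y → g v x ≡ g v y
  g-cong v x≈y = cong (λ s → f v ε Sign.* s) (f-cong v x≈y)

  g-∙ : ∀ v x {h} → h ∈ Member → g v (x ∙ h) ≡ g v x Sign.* φ h
  g-∙ v x {h} h∈H = ≡.trans (cong (λ s → f v ε Sign.* s) (f-∙ v x h∈H)) (≡.sym (Sign.*-assoc (f v ε) _ _))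

  g-member : ∀ v {h} → h ∈ Member → g v h ≡ φ h
  g-member v {h} h∈H = ≡.trans (g-cong v (sym (identityˡ h))) (≡.trans (g-∙ v ε h∈H)
    (cong (λ s → s Sign.* φ h) (Sign.s*s≡+ (f v ε))))

  -- Flipping the sign of one coset.

  toggle : Carrier → Vec Sign order → Vec Sign order
  toggle z v = updateAt v (rep z) opposite

  f-toggle-~ : ∀ v {z x} → z ~ x → f (toggle z v) x ≡ opposite (f v x)
  f-toggle-~ v {z} {x} z~x rewrite rep-cong z~x | Vec.lookup∘updateAt (rep x) {opposite} v =
    opposite-*ˡ (lookup v (rep x)) _

  f-toggle-≁ : ∀ v {z x} → ¬ z ~ x → f (toggle z v) x ≡ f v x
  f-toggle-≁ v {z} {x} z≁x = cong (λ s → s Sign.* φ (element (rep x) ⁻¹ ∙ x))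
    (Vec.lookup∘updateAt′ (rep x) (rep z) (z≁x ∘ ~-sym ∘ rep-injective) v)

  -- As z lies outside H, the coset of ε keeps its sign, and so does the normalising factor `f v ε`.
  g-toggle-~ : ∀ v {z x} → z ∉ Member → z ~ x → g (toggle z v) x ≡ opposite (g v x)
  g-toggle-~ v {z} z∉H z~x = ≡.trans (cong₂ Sign._*_ (f-toggle-≁ v (z∉H ∘ ε~⇒∈ ∘ ~-sym)) (f-toggle-~ v z~x))
    (opposite-*ʳ (f v ε) _)

  g-toggle-≁ : ∀ v {z x} → z ∉ Member → ¬ z ~ x → g (toggle z v) x ≡ g v x
  g-toggle-≁ v {z} z∉H z≁x = cong₂ Sign._*_ (f-toggle-≁ v (z∉H ∘ ε~⇒∈ ∘ ~-sym)) (f-toggle-≁ v z≁x)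

  -- Pointwise lower bounds for the averaged triple product.

  T : Carrier → Carrier → Vec Sign order → ℤ
  T x y v = signToℤ (g v x Sign.* g v y Sign.* g v (x ∙ y))

  T-toggle : ∀ x y z → (∀ v → g (toggle z v) x Sign.* g (toggle z v) y Sign.* g (toggle z v) (x ∙ y)
                              ≡ opposite (g v x Sign.* g v y Sign.* g v (x ∙ y))) →
             sumSigns (T x y) ≡ 0ℤ
  T-toggle x y z odd = sumSigns-odd (T x y) (rep z) (λ v → ≡.trans (cong signToℤ (odd v)) (signToℤ-opposite _))

  -- Of the three factors only the one at x lies over the coset xH, so toggling that coset negates
  -- the product. The next two lemmas argue in the same way with yH and xyH.
  sumSigns-T-x : ∀ {x y} → x ∉ Member → ¬ x ~ y → ¬ x ~ x ∙ y → sumSigns (T x y) ≡ 0ℤ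
  sumSigns-T-x {x} {y} x∉H x≁y x≁xy = T-toggle x y x λ v →
    ≡.trans (cong₂ Sign._*_ (≡.trans (cong₂ Sign._*_ (g-toggle-~ v x∉H (~-reflexive refl)) (g-toggle-≁ v x∉H x≁y))
                                     (opposite-*ˡ (g v x) (g v y)))
                            (g-toggle-≁ v x∉H x≁xy))
            (opposite-*ˡ (g v x Sign.* g v y) (g v (x ∙ y)))

  sumSigns-T-y : ∀ {x y} → y ∉ Member → ¬ y ~ x → ¬ y ~ x ∙ y → sumSigns (T x y) ≡ 0ℤ
  sumSigns-T-y {x} {y} y∉H y≁x y≁xy = T-toggle x y y λ v →
    ≡.trans (cong₂ Sign._*_ (≡.trans (cong₂ Sign._*_ (g-toggle-≁ v y∉H y≁x) (g-toggle-~ v y∉H (~-reflexive refl)))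
                                     (opposite-*ʳ (g v x) (g v y)))
                            (g-toggle-≁ v y∉H y≁xy))
            (opposite-*ˡ (g v x Sign.* g v y) (g v (x ∙ y)))

  sumSigns-T-xy : ∀ {x y} → x ∙ y ∉ Member → ¬ x ∙ y ~ x → ¬ x ∙ y ~ y → sumSigns (T x y) ≡ 0ℤ
  sumSigns-T-xy {x} {y} xy∉H xy≁x xy≁y = T-toggle x y (x ∙ y) λ v →
    ≡.trans (cong₂ Sign._*_ (cong₂ Sign._*_ (g-toggle-≁ v xy∉H xy≁x) (g-toggle-≁ v xy∉H xy≁y))
                            (g-toggle-~ v xy∉H (~-reflexive refl)))
            (opposite-*ʳ (g v x Sign.* g v y) (g v (x ∙ y)))

  -- Bracketed so that `conj y x ∈ Member` is definitionally `y ~ x ∙ y`.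
  conj : Carrier → Carrier → Carrier
  conj y x = y ⁻¹ ∙ (x ∙ y)

  -- For y outside H these carry the two surviving contributions: `A y` is supported on H ∩ yHy⁻¹,
  -- where it is the exact value of the product, and `K y` is the indicator of yH ∩ Hy⁻¹, where the
  -- product may be -1.
  A K : Carrier → Carrier → ℤ
  A y x = 𝟙 (member? x ×-dec member? (conj y x)) ℤ.* signToℤ (φ x Sign.* φ (conj y x))
  K y x = 𝟙 ((y ~? x) ×-dec member? (x ∙ y))

  lower : Carrier → Carrier → ℤ
  lower y x with member? y
  ... | yes _ = 1ℤ
  ... | no _  = A y x ℤ.- K y x

  T-right : ∀ {x y} v → y ∈ Member → T x y v ≡ 1ℤ
  T-right {x} {y} v y∈H = cong signToℤ (begin
    g v x Sign.* g v y Sign.* g v (x ∙ y) ≡⟨ cong₂ (λ s t → g v x Sign.* s Sign.* t) (g-member v y∈H) (g-∙ v x y∈H) ⟩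
    (g v x Sign.* φ y) Sign.* (g v x Sign.* φ y) ≡⟨ Sign.s*s≡+ (g v x Sign.* φ y) ⟩
    Sign.+ ∎)
    where open ≡-Reasoning

  -- Since xy = y(y⁻¹xy), the sign `g v y` occurs twice and cancels.
  T-conj : ∀ {x y} v → x ∈ Member → conj y x ∈ Member → T x y v ≡ signToℤ (φ x Sign.* φ (conj y x))
  T-conj {x} {y} v x∈H xʸ∈H = cong signToℤ (begin
    g v x Sign.* g v y Sign.* g v (x ∙ y)
      ≡⟨ cong₂ (λ s t → s Sign.* g v y Sign.* t) (g-member v x∈H)
           (≡.trans (g-cong v (sym (\\-leftDividesˡ y (x ∙ y)))) (g-∙ v y xʸ∈H)) ⟩
    φ x Sign.* g v y Sign.* (g v y Sign.* φ (conj y x))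
      ≡⟨ cancel (φ x) (g v y) (φ (conj y x)) ⟩
    φ x Sign.* φ (conj y x) ∎)
    where
    open ≡-Reasoning
    cancel : ∀ a b c → a Sign.* b Sign.* (b Sign.* c) ≡ a Sign.* c
    cancel a b c = ≡.trans (Sign.*-assoc a b _) (cong (λ s → a Sign.* s)
      (≡.trans (≡.sym (Sign.*-assoc b b c)) (cong (λ s → s Sign.* c) (Sign.s*s≡+ b))))

  0≤K : ∀ y x → 0ℤ ℤ.≤ K y x
  0≤K y x = 0≤𝟙 ((y ~? x) ×-dec member? (x ∙ y))

  A-in : ∀ {x y} → x ∈ Member → conj y x ∈ Member → A y x ≡ signToℤ (φ x Sign.* φ (conj y x))
  A-in {x} {y} x∈H xʸ∈H rewrite 𝟙-yes (member? x ×-dec member? (conj y x)) (x∈H , xʸ∈H) = ℤ.*-identityˡ _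

  A-out : ∀ {x y} → ¬ (x ∈ Member × conj y x ∈ Member) → A y x ≡ 0ℤ
  A-out {x} {y} ¬xʸ rewrite 𝟙-no (member? x ×-dec member? (conj y x)) ¬xʸ = ≡.refl

  lower-in : ∀ {y} x → y ∈ Member → lower y x ≡ 1ℤ
  lower-in {y} x y∈H with member? y
  ... | yes _  = ≡.refl
  ... | no y∉H = contradiction y∈H y∉H

  lower-out : ∀ {y} x → y ∉ Member → lower y x ≡ A y x ℤ.- K y x
  lower-out {y} x y∉H with member? y
  ... | yes y∈H = contradiction y∈H y∉H
  ... | no _    = ≡.refl

  A-K≤A : ∀ y x → A y x ℤ.- K y x ℤ.≤ A y x
  A-K≤A y x = ℤ.i-j≤i (A y x) (K y x) {{ℤ.nonNegative (0≤K y x)}}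

  -- If some coset other than H contains an odd number of x, y and xy, toggling its sign
  -- shows that T x y averages to 0.
  sumSigns-lower-out : ∀ {x y} → y ∉ Member →
    sumSigns {order} (λ _ → A y x ℤ.- K y x) ℤ.≤ sumSigns (T x y)
  sumSigns-lower-out {x} {y} y∉H = split (member? x) (member? (conj y x)) (x ~? y) (member? (x ∙ y))
    where
    Goal = sumSigns {order} (λ _ → A y x ℤ.- K y x) ℤ.≤ sumSigns (T x y)

    pointwise : (∀ v → A y x ℤ.- K y x ℤ.≤ T x y v) → Goal
    pointwise = sumSigns-mono

    vanishing : ¬ (x ∈ Member × conj y x ∈ Member) → sumSigns (T x y) ≡ 0ℤ → Goal
    vanishing ¬xʸ T≡0 = ℤ.≤-trans
      (sumSigns-mono {order} (λ _ → ℤ.≤-trans (A-K≤A y x) (ℤ.≤-reflexive (A-out ¬xʸ))))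
      (ℤ.≤-reflexive (≡.trans (sumSigns-0 order) (≡.sym T≡0)))

    x≁xy : ¬ x ~ x ∙ y
    x≁xy x~xy = y∉H (resp (\\-leftDividesʳ x y) x~xy)

    split : Dec (x ∈ Member) → Dec (conj y x ∈ Member) → Dec (x ~ y) → Dec (x ∙ y ∈ Member) → Goal
    split (yes x∈H) (yes xʸ∈H) _ _ = pointwise λ v → ℤ.≤-trans (A-K≤A y x)
      (ℤ.≤-reflexive (≡.trans (A-in x∈H xʸ∈H) (≡.sym (T-conj v x∈H xʸ∈H))))
    -- The coset yH contains neither x, which lies in H, nor xy.
    split (yes x∈H) (no xʸ∉H) _ _ = vanishing (xʸ∉H ∘ proj₂)
      (sumSigns-T-y y∉H (λ y~x → y∉H (ε~⇒∈ (~-trans (∈⇒ε~ x∈H) (~-sym y~x)))) xʸ∉H)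
    -- The coset xH does not contain xy, because y is outside H.
    split (no x∉H) _ (no x≁y) _ = vanishing (x∉H ∘ proj₁) (sumSigns-T-x x∉H x≁y x≁xy)
    -- Toggling gives no cancellation here: x and y share a coset and xy lies in H. The trivial
    -- bound -1 is paid for by `K y x` = 1.
    split (no x∉H) _ (yes x~y) (yes xy∈H) = pointwise λ v → ℤ.≤-trans
      (ℤ.≤-reflexive (cong₂ ℤ._-_ (A-out (x∉H ∘ proj₁))
        (𝟙-yes ((y ~? x) ×-dec member? (x ∙ y)) (~-sym x~y , xy∈H))))
      (-1≤signToℤ _)
    -- Here xH = yH, and xy lies in a different coset outside H.
    split (no x∉H) _ (yes x~y) (no xy∉H) = vanishing (x∉H ∘ proj₁)
      (sumSigns-T-xy xy∉H (x≁xy ∘ ~-sym) (λ xy~y → x≁xy (~-trans x~y (~-sym xy~y))))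

  sumSigns-lower : ∀ x y → sumSigns {order} (λ _ → lower y x) ℤ.≤ sumSigns (T x y)
  sumSigns-lower x y = split (member? y)
    where
    split : Dec (y ∈ Member) → sumSigns {order} (λ _ → lower y x) ℤ.≤ sumSigns (T x y)
    split (yes y∈H) = sumSigns-mono (λ v →
      ℤ.≤-reflexive (≡.trans (lower-in x y∈H) (≡.sym (T-right v y∈H))))
    split (no y∉H) = ℤ.≤-trans (sumSigns-mono {order} (λ _ → ℤ.≤-reflexive (lower-out x y∉H)))
      (sumSigns-lower-out y∉H)

  -- Nonnegativity of the character sums.

  conj-cong : ∀ y {x x′} → x ≈ x′ → conj y x ≈ conj y x′
  conj-cong y x≈x′ = ∙-congˡ (∙-congʳ x≈x′)

  conj-∙ : ∀ y x x′ → conj y x ∙ conj y x′ ≈ conj y (x ∙ x′)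
  conj-∙ y x x′ = trans (assoc _ _ _) (∙-congˡ (trans (assoc _ _ _)
    (trans (∙-congˡ (\\-leftDividesˡ y (x′ ∙ y))) (sym (assoc _ _ _)))))

  A-cong : ∀ y → Congruent (A y)
  A-cong y {x} {x′} x≈x′ = cong₂ ℤ._*_
    (𝟙-⇔ (member? x ×-dec member? (conj y x)) (member? x′ ×-dec member? (conj y x′))
      (λ (x∈H , xʸ∈H) → resp x≈x′ x∈H , resp (conj-cong y x≈x′) xʸ∈H)
      (λ (x∈H , xʸ∈H) → resp (sym x≈x′) x∈H , resp (conj-cong y (sym x≈x′)) xʸ∈H))
    (cong signToℤ (cong₂ Sign._*_ (φ-cong x≈x′) (φ-cong (conj-cong y x≈x′))))

  -- Left multiplication by a preserves H ∩ yHy⁻¹ and its complement; on the former the character is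
  -- multiplied by its value - at a, on the latter both sides are 0.
  A-shift : ∀ y {a} → a ∈ Member → conj y a ∈ Member → φ a Sign.* φ (conj y a) ≡ Sign.- →
            ∀ x → A y (a ∙ x) ≡ ℤ.- A y x
  A-shift y {a} a∈H aʸ∈H odd x = split (member? x ×-dec member? (conj y x))
    where
    split : Dec (x ∈ Member × conj y x ∈ Member) → A y (a ∙ x) ≡ ℤ.- A y x
    split (yes (x∈H , xʸ∈H)) = begin
      A y (a ∙ x)
        ≡⟨ A-in (∙-closed a∈H x∈H) (resp (conj-∙ y a x) (∙-closed aʸ∈H xʸ∈H)) ⟩
      signToℤ (φ (a ∙ x) Sign.* φ (conj y (a ∙ x)))
        ≡⟨ cong signToℤ (cong₂ Sign._*_ (φ-∙ a∈H x∈H)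
             (≡.trans (φ-cong (sym (conj-∙ y a x))) (φ-∙ aʸ∈H xʸ∈H))) ⟩
      signToℤ (φ a Sign.* φ x Sign.* (φ (conj y a) Sign.* φ (conj y x)))
        ≡⟨ cong signToℤ (interchange (φ a) (φ x) (φ (conj y a)) (φ (conj y x))) ⟩
      signToℤ (φ a Sign.* φ (conj y a) Sign.* (φ x Sign.* φ (conj y x)))
        ≡⟨ cong (λ s → signToℤ (s Sign.* (φ x Sign.* φ (conj y x)))) odd ⟩
      signToℤ (opposite (φ x Sign.* φ (conj y x)))
        ≡⟨ signToℤ-opposite _ ⟩
      ℤ.- signToℤ (φ x Sign.* φ (conj y x))
        ≡⟨ cong ℤ.-_ (A-in x∈H xʸ∈H) ⟨
      ℤ.- A y x ∎
      where
      open ≡-Reasoning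
      open CommutativeSemigroupProperties Sign.*-commutativeSemigroup using (interchange)
    split (no ¬xʸ) = ≡.trans
      (A-out (λ (ax∈H , axʸ∈H) → ¬xʸ (∈-∙ˡ⁻ a∈H ax∈H , ∈-∙ˡ⁻ aʸ∈H (resp (sym (conj-∙ y a x)) axʸ∈H))))
      (≡.sym (cong ℤ.-_ (A-out ¬xʸ)))

  -- A y is a character of the subgroup H ∩ y H y⁻¹, extended by 0.
  0≤∑A : ∀ y → 0ℤ ℤ.≤ ∑ (A y)
  0≤∑A y = split (Fin.any? (odd? ∘ element))
    where
    Odd : Carrier → Set _
    Odd a = (a ∈ Member × conj y a ∈ Member) × φ a Sign.* φ (conj y a) ≡ Sign.-
    odd? : Decidable Odd
    odd? a = (member? a ×-dec member? (conj y a)) ×-dec (φ a Sign.* φ (conj y a) Sign.≟ Sign.-)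
    0≤A : ∀ x → ¬ Odd x → 0ℤ ℤ.≤ A y x
    0≤A x ¬odd with member? x ×-dec member? (conj y x)
    ... | no _ = ℤ.≤-refl
    ... | yes xʸ with φ x Sign.* φ (conj y x)
    ...   | Sign.+ = ℤ.+≤+ ℕ.z≤n
    ...   | Sign.- = contradiction (xʸ , ≡.refl) ¬odd
    split : Dec (∃ (Odd ∘ element)) → 0ℤ ℤ.≤ ∑ (A y)
    -- If the character is nontrivial its sum vanishes; otherwise every term is nonnegative.
    split (yes (i , (a∈H , aʸ∈H) , odd)) = ℤ.≤-reflexive (≡.sym
      (∑-odd (element i ∙_) (∑-shiftˡ (A-cong y) (element i)) (A-shift y a∈H aʸ∈H odd)))
    split (no none) = ℤ.≤-trans (ℤ.≤-reflexive (≡.sym (sum-replicate-zero order)))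
      (sum-mono (λ i → 0≤A (element i) (λ odd → none (i , odd))))

  -- Counting yH ∩ Hy⁻¹.

  ∣H∣ ∣N∣ : ℕ
  ∣H∣ = card member?
  ∣N∣ = card normalizer?

  ∑-coset : ∀ y → ∑ (λ x → 𝟙 (y ~? x)) ≡ + ∣H∣
  ∑-coset y = ≡.trans
    (∑-shiftˡ (λ {x} {x′} x≈x′ → 𝟙-⇔ (member? x) (member? x′) (resp x≈x′) (resp (sym x≈x′))) (y ⁻¹))
    (≡.sym (length-filter-tabulate member? element))

  K≤coset : ∀ y x → K y x ℤ.≤ 𝟙 (y ~? x)
  K≤coset y x with y ~? x | member? (x ∙ y)
  ... | yes _ | yes _ = ℤ.≤-refl
  ... | yes _ | no _  = ℤ.+≤+ ℕ.z≤n
  ... | no _  | _     = ℤ.≤-refl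

  K-cong : ∀ y → Congruent (K y)
  K-cong y {x} {x′} x≈x′ = 𝟙-⇔ ((y ~? x) ×-dec member? (x ∙ y)) ((y ~? x′) ×-dec member? (x′ ∙ y))
    (λ (y~x , xy∈H) → resp (∙-congˡ x≈x′) y~x , resp (∙-congʳ x≈x′) xy∈H)
    (λ (y~x , xy∈H) → resp (∙-congˡ (sym x≈x′)) y~x , resp (∙-congʳ (sym x≈x′)) xy∈H)

  -- `K y` and `K y ∘ σ` are indicators of disjoint subsets of the coset yH and have equal sums.
  2∑K≤∣H∣ : ∀ y (σ : Carrier → Carrier) → ∑ (K y ∘ σ) ≡ ∑ (K y) →
            (∀ {x} → y ~ σ x → y ~ x) → (∀ {x} → x ∙ y ∈ Member → σ x ∙ y ∉ Member) →
            + 2 ℤ.* ∑ (K y) ℤ.≤ + ∣H∣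
  2∑K≤∣H∣ y σ ∑Kσ≡∑K σ-coset σ-moves = begin
    + 2 ℤ.* ∑ (K y)                   ≡⟨ solve 1 (λ k → con (+ 2) :* k := k :+ k) ≡.refl (∑ (K y)) ⟩
    ∑ (K y) ℤ.+ ∑ (K y)               ≡⟨ cong (λ k → ∑ (K y) ℤ.+ k) ∑Kσ≡∑K ⟨
    ∑ (K y) ℤ.+ ∑ (K y ∘ σ)           ≡⟨ ∑-distrib-+ (K y ∘ element) (K y ∘ σ ∘ element) ⟨
    ∑ (λ x → K y x ℤ.+ K y (σ x))     ≤⟨ sum-mono (disjoint ∘ element) ⟩
    ∑ (λ x → 𝟙 (y ~? x))              ≡⟨ ∑-coset y ⟩
    + ∣H∣                             ∎
    where
    open ℤ.≤-Reasoning
    open +-*-Solver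
    K-out : ∀ x → ¬ (y ~ x × x ∙ y ∈ Member) → K y x ≡ 0ℤ
    K-out x = 𝟙-no ((y ~? x) ×-dec member? (x ∙ y))
    disjoint : ∀ x → K y x ℤ.+ K y (σ x) ℤ.≤ 𝟙 (y ~? x)
    disjoint x = split (y ~? x) (member? (x ∙ y))
      where
      split : Dec (y ~ x) → Dec (x ∙ y ∈ Member) → K y x ℤ.+ K y (σ x) ℤ.≤ 𝟙 (y ~? x)
      split (yes y~x) (no xy∉H) = begin
        K y x ℤ.+ K y (σ x)   ≡⟨ cong (λ k → k ℤ.+ K y (σ x)) (K-out x (xy∉H ∘ proj₂)) ⟩
        0ℤ ℤ.+ K y (σ x)      ≡⟨ ℤ.+-identityˡ _ ⟩
        K y (σ x)             ≤⟨ 𝟙≤1 ((y ~? σ x) ×-dec member? (σ x ∙ y)) ⟩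
        1ℤ                    ≡⟨ 𝟙-yes (y ~? x) y~x ⟨
        𝟙 (y ~? x)            ∎
      split (yes _) (yes xy∈H) = begin
        K y x ℤ.+ K y (σ x)   ≡⟨ cong (λ k → K y x ℤ.+ k) (K-out (σ x) (σ-moves xy∈H ∘ proj₂)) ⟩
        K y x ℤ.+ 0ℤ          ≡⟨ ℤ.+-identityʳ _ ⟩
        K y x                 ≤⟨ K≤coset y x ⟩
        𝟙 (y ~? x)            ∎
      split (no y≁x) _ = begin
        K y x ℤ.+ K y (σ x)   ≡⟨ cong₂ ℤ._+_ (K-out x (y≁x ∘ proj₁)) (K-out (σ x) (y≁x ∘ σ-coset ∘ proj₁)) ⟩
        0ℤ                    ≤⟨ 0≤𝟙 (y ~? x) ⟩
        𝟙 (y ~? x)            ∎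

  conj⇒Conjugate : ∀ {y x} → conj y x ∈ Member → Conjugate y x
  conj⇒Conjugate {y} {x} xʸ∈H = conj y x , xʸ∈H , (begin
    x                            ≈⟨ //-rightDividesʳ y x ⟨
    x ∙ y ∙ y ⁻¹                 ≈⟨ ∙-congʳ (\\-leftDividesˡ y (x ∙ y)) ⟨
    y ∙ conj y x ∙ y ⁻¹          ∎)
    where open SetoidReasoning setoid

  ∈⇒Normalizer : ∀ {y} → y ∈ Member → y ∈ Normalizer
  ∈⇒Normalizer y∈H =
    (λ (h , h∈H , eq) → resp (sym eq) (∙-closed (∙-closed y∈H h∈H) (⁻¹-closed y∈H))) ,
    (λ x∈H → conj⇒Conjugate (∙-closed (⁻¹-closed y∈H) (∙-closed x∈H y∈H)))

  ∉Normalizer⇒2∑K≤∣H∣ : ∀ {y} → y ∉ Normalizer → + 2 ℤ.* ∑ (K y) ℤ.≤ + ∣H∣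
  ∉Normalizer⇒2∑K≤∣H∣ {y} y∉N = split
    (any? (λ h≈k (h∈H , ∉H) → resp h≈k h∈H , ∉H ∘ resp (∙-congʳ (∙-congˡ (sym h≈k))))
          (λ h → member? h ×-dec ¬? (member? (y ∙ h ∙ y ⁻¹))))
    (any? (λ h≈k (h∈H , ∉H) → resp h≈k h∈H , ∉H ∘ resp (conj-cong y (sym h≈k)))
          (λ h → member? h ×-dec ¬? (member? (conj y h))))
    where
    split : Dec (∃ λ h → h ∈ Member × y ∙ h ∙ y ⁻¹ ∉ Member) →
            Dec (∃ λ h → h ∈ Member × conj y h ∉ Member) → + 2 ℤ.* ∑ (K y) ℤ.≤ + ∣H∣
    -- For σ x = yhy⁻¹x, y⁻¹(σ x) = h(y⁻¹x) keeps σ x in the coset of x within yH, while (σ x)y =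
    -- (yhy⁻¹)(xy) leaves H.
    split (yes (h , h∈H , ∉H)) _ = 2∑K≤∣H∣ y (y ∙ h ∙ y ⁻¹ ∙_) (∑-shiftˡ (K-cong y) _)
      (λ {x} y~σx → ∈-∙ˡ⁻ h∈H (resp (trans (∙-congˡ (trans (assoc _ _ _) (assoc _ _ _)))
                                             (\\-leftDividesʳ y _)) y~σx))
      (λ xy∈H σxy∈H → ∉H (∈-∙ʳ⁻ xy∈H (resp (assoc _ _ _) σxy∈H)))
    -- For σ x = xh, (σ x)y = (xy)(y⁻¹hy) leaves H.
    split (no _) (yes (h , h∈H , ∉H)) = 2∑K≤∣H∣ y (_∙ h) (∑-shiftʳ (K-cong y) h)
      (λ y~σx → ∈-∙ʳ⁻ h∈H (resp (sym (assoc _ _ _)) y~σx))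
      (λ {x} xy∈H σxy∈H → ∉H (∈-∙ˡ⁻ xy∈H (resp (trans (assoc x h y)
        (sym (trans (assoc x y _) (∙-congˡ (\\-leftDividesˡ y (h ∙ y)))))) σxy∈H)))
    -- If both searches fail, the two inclusions between yHy⁻¹ and H hold, so y normalises H.
    split (no closed) (no closed⁻¹) = ⊥-elim (y∉N
      ( (λ (h , h∈H , eq) → resp (sym eq) (decidable-stable (member? _) (λ ∉H → closed (h , h∈H , ∉H))))
      , (λ {x} x∈H → conj⇒Conjugate (decidable-stable (member? _) (λ ∉H → closed⁻¹ (x , x∈H , ∉H))))))

  -- On the normaliser this is the trivial count by the whole coset yH; off it the halved count
  -- applies. The indicator merges the two.
  2∑K≤ : ∀ y → + 2 ℤ.* ∑ (K y) ℤ.≤ + ∣H∣ ℤ.+ + ∣H∣ ℤ.* 𝟙 (normalizer? y)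
  2∑K≤ y with normalizer? y
  ... | yes _ = begin
    + 2 ℤ.* ∑ (K y)               ≤⟨ ℤ.*-monoˡ-≤-nonNeg (+ 2) (sum-mono (K≤coset y ∘ element)) ⟩
    + 2 ℤ.* ∑ (λ x → 𝟙 (y ~? x))  ≡⟨ cong (+ 2 ℤ.*_) (∑-coset y) ⟩
    + 2 ℤ.* + ∣H∣
      ≡⟨ solve 1 (λ h → con (+ 2) :* h := h :+ h :* con 1ℤ) ≡.refl (+ ∣H∣) ⟩
    + ∣H∣ ℤ.+ + ∣H∣ ℤ.* 1ℤ        ∎
    where
    open ℤ.≤-Reasoning
    open +-*-Solver
  ... | no y∉N = ℤ.≤-trans (∉Normalizer⇒2∑K≤∣H∣ y∉N)
    (ℤ.≤-reflexive (solve 1 (λ h → h := h :+ h :* con 0ℤ) ≡.refl (+ ∣H∣)))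
    where open +-*-Solver

  -- Summing the lower bounds over all pairs.

  -- Affine in two indicators, so that its sum is a polynomial in the cardinalities. As H lies in
  -- its normaliser, the values are 2 `order` on H, -2 `∣H∣` on the rest of the normaliser and
  -- -`∣H∣` elsewhere.
  β : Carrier → ℤ
  β y = (+ 2 ℤ.* + order ℤ.+ + 2 ℤ.* + ∣H∣) ℤ.* 𝟙 (member? y)
          ℤ.+ (ℤ.- + ∣H∣ ℤ.* 𝟙 (normalizer? y) ℤ.+ ℤ.- + ∣H∣)

  β≤2∑lower : ∀ y → β y ℤ.≤ + 2 ℤ.* ∑ (lower y)
  β≤2∑lower y = split (member? y)
    where
    open ℤ.≤-Reasoning
    open +-*-Solver
    split : Dec (y ∈ Member) → β y ℤ.≤ + 2 ℤ.* ∑ (lower y)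
    split (yes y∈H) = begin
      β y
        ≡⟨ cong₂ (λ a b → (+ 2 ℤ.* + order ℤ.+ + 2 ℤ.* + ∣H∣) ℤ.* a ℤ.+ (ℤ.- + ∣H∣ ℤ.* b ℤ.+ ℤ.- + ∣H∣))
             (𝟙-yes (member? y) y∈H) (𝟙-yes (normalizer? y) (∈⇒Normalizer y∈H)) ⟩
      (+ 2 ℤ.* + order ℤ.+ + 2 ℤ.* + ∣H∣) ℤ.* 1ℤ ℤ.+ (ℤ.- + ∣H∣ ℤ.* 1ℤ ℤ.+ ℤ.- + ∣H∣)
        ≡⟨ solve 2 (λ n h → (con (+ 2) :* n :+ con (+ 2) :* h) :* con 1ℤ :+ (:- h :* con 1ℤ :+ :- h)
             := con (+ 2) :* (n :* con 1ℤ)) ≡.refl (+ order) (+ ∣H∣) ⟩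
      + 2 ℤ.* (+ order ℤ.* 1ℤ)
        ≡⟨ cong (+ 2 ℤ.*_) (sum-const order 1ℤ) ⟨
      + 2 ℤ.* ∑ (λ _ → 1ℤ)
        ≡⟨ cong (+ 2 ℤ.*_) (sum-cong-≗ (λ i → lower-in (element i) y∈H)) ⟨
      + 2 ℤ.* ∑ (lower y) ∎
    split (no y∉H) = begin
      β y
        ≡⟨ cong (λ a → (+ 2 ℤ.* + order ℤ.+ + 2 ℤ.* + ∣H∣) ℤ.* a
                         ℤ.+ (ℤ.- + ∣H∣ ℤ.* 𝟙 (normalizer? y) ℤ.+ ℤ.- + ∣H∣)) (𝟙-no (member? y) y∉H) ⟩
      (+ 2 ℤ.* + order ℤ.+ + 2 ℤ.* + ∣H∣) ℤ.* 0ℤ ℤ.+ (ℤ.- + ∣H∣ ℤ.* 𝟙 (normalizer? y) ℤ.+ ℤ.- + ∣H∣)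
        ≡⟨ solve 3 (λ c h m → c :* con 0ℤ :+ (:- h :* m :+ :- h) := con (+ 2) :* con 0ℤ :+ :- (h :+ h :* m)) ≡.refl
             (+ 2 ℤ.* + order ℤ.+ + 2 ℤ.* + ∣H∣) (+ ∣H∣) (𝟙 (normalizer? y)) ⟩
      + 2 ℤ.* 0ℤ ℤ.+ ℤ.- (+ ∣H∣ ℤ.+ + ∣H∣ ℤ.* 𝟙 (normalizer? y))
        ≤⟨ ℤ.+-mono-≤ (ℤ.*-monoˡ-≤-nonNeg (+ 2) (0≤∑A y)) (ℤ.neg-mono-≤ (2∑K≤ y)) ⟩
      + 2 ℤ.* ∑ (A y) ℤ.+ ℤ.- (+ 2 ℤ.* ∑ (K y))
        ≡⟨ solve 2 (λ a k → con (+ 2) :* a :+ :- (con (+ 2) :* k) := con (+ 2) :* (a :+ :- k)) ≡.refl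
             (∑ (A y)) (∑ (K y)) ⟩
      + 2 ℤ.* (∑ (A y) ℤ.+ ℤ.- ∑ (K y))
        ≡⟨ cong (λ k → + 2 ℤ.* (∑ (A y) ℤ.+ k)) (sum-neg (K y ∘ element)) ⟨
      + 2 ℤ.* (∑ (A y) ℤ.+ ∑ (λ x → ℤ.- K y x))
        ≡⟨ cong (+ 2 ℤ.*_) (∑-distrib-+ (A y ∘ element) (λ i → ℤ.- K y (element i))) ⟨
      + 2 ℤ.* ∑ (λ x → A y x ℤ.- K y x)
        ≡⟨ cong (+ 2 ℤ.*_) (sum-cong-≗ (λ i → lower-out (element i) y∉H)) ⟨
      + 2 ℤ.* ∑ (lower y) ∎

  ∑β : ∑ β ≡ + order ℤ.* + ∣H∣ ℤ.+ + 2 ℤ.* (+ ∣H∣ ℤ.* + ∣H∣) ℤ.- + ∣H∣ ℤ.* + ∣N∣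
  ∑β = begin
    ∑ β
      ≡⟨ ∑-distrib-+ (λ i → c₁ ℤ.* 𝟙 (member? (element i)))
           (λ i → ℤ.- + ∣H∣ ℤ.* 𝟙 (normalizer? (element i)) ℤ.+ ℤ.- + ∣H∣) ⟩
    ∑ (λ y → c₁ ℤ.* 𝟙 (member? y)) ℤ.+ ∑ (λ y → ℤ.- + ∣H∣ ℤ.* 𝟙 (normalizer? y) ℤ.+ ℤ.- + ∣H∣)
      ≡⟨ cong₂ ℤ._+_ (scaled c₁ member?) (≡.trans
           (∑-distrib-+ (λ i → ℤ.- + ∣H∣ ℤ.* 𝟙 (normalizer? (element i))) (λ _ → ℤ.- + ∣H∣))
           (cong₂ ℤ._+_ (scaled (ℤ.- + ∣H∣) normalizer?) (sum-const order (ℤ.- + ∣H∣)))) ⟩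
    c₁ ℤ.* + ∣H∣ ℤ.+ (ℤ.- + ∣H∣ ℤ.* + ∣N∣ ℤ.+ + order ℤ.* (ℤ.- + ∣H∣))
      ≡⟨ solve 3 (λ n h k → (con (+ 2) :* n :+ con (+ 2) :* h) :* h :+ (:- h :* k :+ n :* (:- h))
           := n :* h :+ con (+ 2) :* (h :* h) :- h :* k) ≡.refl (+ order) (+ ∣H∣) (+ ∣N∣) ⟩
    _ ∎
    where
    open ≡-Reasoning
    open +-*-Solver
    c₁ = + 2 ℤ.* + order ℤ.+ + 2 ℤ.* + ∣H∣
    scaled : ∀ {q} {P : Pred Carrier q} c (P? : Decidable P) → ∑ (λ y → c ℤ.* 𝟙 (P? y)) ≡ c ℤ.* + card P?
    scaled c P? = ≡.trans (sum-*ˡ c (λ i → 𝟙 (P? (element i))))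
      (cong (c ℤ.*_) (≡.sym (length-filter-tabulate P? element)))

  ∑∑lower : ℤ
  ∑∑lower = ∑ (λ x → ∑ (λ y → lower y x))

  ∑β≤2∑∑lower : ∑ β ℤ.≤ + 2 ℤ.* ∑∑lower
  ∑β≤2∑∑lower = begin
    ∑ β                             ≤⟨ sum-mono (β≤2∑lower ∘ element) ⟩
    ∑ (λ y → + 2 ℤ.* ∑ (lower y))   ≡⟨ sum-*ˡ (+ 2) (λ i → ∑ (lower (element i))) ⟩
    + 2 ℤ.* ∑ (λ y → ∑ (lower y))
      ≡⟨ cong (+ 2 ℤ.*_) (∑-comm (λ i j → lower (element i) (element j))) ⟩
    + 2 ℤ.* ∑∑lower                 ∎
    where open ℤ.≤-Reasoning

  -- Choice of signs, mean zero and the final count.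

  -- The pointwise bounds hold for the sum over all v; exchanging the order of summation leaves an
  -- average over v, which some v reaches.
  good-signs : ∃ λ v → ∑∑lower ℤ.≤ ∑ (λ x → ∑ (λ y → T x y v))
  good-signs = sumSigns-∃ ∑∑lower (λ v → ∑ (λ x → ∑ (λ y → T x y v))) (begin
    sumSigns {order} (λ _ → ∑∑lower)
      ≡⟨ exchange (λ x y _ → lower y x) ⟩
    ∑ (λ x → ∑ (λ y → sumSigns {order} (λ _ → lower y x)))
      ≤⟨ sum-mono (λ i → sum-mono (λ j → sumSigns-lower (element i) (element j))) ⟩
    ∑ (λ x → ∑ (λ y → sumSigns (T x y)))
      ≡⟨ exchange T ⟨
    sumSigns (λ v → ∑ (λ x → ∑ (λ y → T x y v))) ∎)
    where
    open ℤ.≤-Reasoning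
    exchange : ∀ (F : Carrier → Carrier → Vec Sign order → ℤ) →
               sumSigns (λ v → ∑ (λ x → ∑ (λ y → F x y v))) ≡ ∑ (λ x → ∑ (λ y → sumSigns (F x y)))
    exchange F = ≡.trans (sumSigns-sum (λ i v → ∑ (λ y → F (element i) y v)))
      (sum-cong-≗ (λ i → sumSigns-sum (λ j → F (element i) (element j))))

  ĝ : Vec Sign order → setoid ⟶ₛ Signs
  ĝ v = record { to = g v ; cong = g-cong v }

  𝔼-ĝ : ∀ v → 𝔼 (λ x → signToℤ (ĝ v ⟨$⟩ x)) ≡ 0ℚ
  𝔼-ĝ v = ≡.trans (cong (_/ order) (≡.trans (foldr-tabulate (signToℤ ∘ g v) element) ∑g≡0)) (ℚ.0/n≡0 order)
    where
    h = proj₁ φ-nontrivial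
    ∑g≡0 : ∑ (signToℤ ∘ g v) ≡ 0ℤ
    ∑g≡0 = ∑-odd (_∙ h) (∑-shiftʳ (cong signToℤ ∘ g-cong v) h) λ x → begin
      signToℤ (g v (x ∙ h))         ≡⟨ cong signToℤ (g-∙ v x (proj₁ (proj₂ φ-nontrivial))) ⟩
      signToℤ (g v x Sign.* φ h)    ≡⟨ cong (λ s → signToℤ (g v x Sign.* s)) (proj₂ (proj₂ φ-nontrivial)) ⟩
      signToℤ (g v x Sign.* Sign.-) ≡⟨ cong signToℤ (Sign.*-comm (g v x) Sign.-) ⟩
      signToℤ (opposite (g v x))    ≡⟨ signToℤ-opposite (g v x) ⟩
      ℤ.- signToℤ (g v x)           ∎
      where open ≡-Reasoning

  -- Each `T x y v` is 1 on a multiplicative pair and -1 otherwise, that is, twice the indicator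
  -- minus 1.
  ∑∑T : ∀ v → ∑ (λ x → ∑ (λ y → T x y v))
            ≡ + 2 ℤ.* + length (filter (multiplicative? G (ĝ v)) (cartesianProduct elements elements))
              ℤ.+ + order ℤ.* (+ order ℤ.* -1ℤ)
  ∑∑T v = begin
    ∑ (λ x → ∑ (λ y → T x y v))
      ≡⟨ sum-cong-≗ (λ i → ≡.trans
           (sum-cong-≗ (λ j → signToℤ-≟ (g v (element i) Sign.* g v (element j)) (g v (element i ∙ element j))))
           (affine (λ j → M (element i) (element j)) -1ℤ)) ⟩
    ∑ (λ x → + 2 ℤ.* ∑ (M x) ℤ.+ + order ℤ.* -1ℤ)
      ≡⟨ affine (λ i → ∑ (M (element i))) (+ order ℤ.* -1ℤ) ⟩
    + 2 ℤ.* ∑ (λ x → ∑ (M x)) ℤ.+ + order ℤ.* (+ order ℤ.* -1ℤ)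
      ≡⟨ cong (λ m → + 2 ℤ.* m ℤ.+ + order ℤ.* (+ order ℤ.* -1ℤ))
           (length-filter-cartesianProduct (multiplicative? G (ĝ v)) element element) ⟨
    _ ∎
    where
    open ≡-Reasoning
    M : Carrier → Carrier → ℤ
    M x y = 𝟙 (multiplicative? G (ĝ v) (x , y))
    affine : ∀ (F : Fin order → ℤ) k → sum (λ i → + 2 ℤ.* F i ℤ.+ k) ≡ + 2 ℤ.* sum F ℤ.+ + order ℤ.* k
    affine F k = ≡.trans (∑-distrib-+ (λ i → + 2 ℤ.* F i) (λ _ → k))
      (cong₂ ℤ._+_ (sum-*ˡ (+ 2) F) (sum-const order k))

theorem3 : ∀ {c ℓ p : Level} (G : FiniteGroup c ℓ) (H : Subgroup G p) →
    NontrivialCharacter (Subgroup.group H) →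
    let open FiniteGroup G
        ∣G∣ = order
        ∣H∣ = card (Subgroup.member? H)
        ∣N∣ = card (Subgroup.normalizer? H)
    in Σ (setoid ⟶ₛ Signs) λ f →
         𝔼 (λ x → signToℤ (f ⟨$⟩ x)) ≡ 0ℚ
         × Pr (multiplicative? G f)
             ≥ ½ * (1ℚ + ½ * ((+ ∣H∣) / ∣G∣) * (1ℚ - ((+ ∣N∣) / ∣G∣))
                       + ((+ (∣H∣ ℕ.* ∣H∣)) / (∣G∣ ℕ.* ∣G∣)))
theorem3 G H χ = ĝ v , 𝔼-ĝ v , ratio-bound order count ∣H∣ ∣N∣ (begin
  + 2 ℤ.* (+ order ℤ.* + order) ℤ.+ (+ order ℤ.* + ∣H∣ ℤ.+ + 2 ℤ.* (+ ∣H∣ ℤ.* + ∣H∣) ℤ.- + ∣H∣ ℤ.* + ∣N∣)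
    ≡⟨ cong (λ b → 2n² ℤ.+ b) ∑β ⟨
  2n² ℤ.+ ∑ β
    ≤⟨ ℤ.+-monoʳ-≤ 2n² (ℤ.≤-trans ∑β≤2∑∑lower (ℤ.*-monoˡ-≤-nonNeg (+ 2) (proj₂ good-signs))) ⟩
  2n² ℤ.+ + 2 ℤ.* ∑ (λ x → ∑ (λ y → T x y v))
    ≡⟨ cong (λ t → 2n² ℤ.+ + 2 ℤ.* t) (∑∑T v) ⟩
  2n² ℤ.+ + 2 ℤ.* (+ 2 ℤ.* + count ℤ.+ + order ℤ.* (+ order ℤ.* -1ℤ))
    -- The doubled sum of `T` is 4 `count` minus `2n²`, so the added `2n²` cancels.
    ≡⟨ solve 2 (λ n m → con (+ 2) :* (n :* n) :+ con (+ 2) :* (con (+ 2) :* m :+ n :* (n :* con -1ℤ))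
         := con (+ 4) :* m) ≡.refl (+ order) (+ count) ⟩
  + 4 ℤ.* + count ∎)
  where
  open FiniteGroup G
  open FiniteGroupSums G
  open Character G H χ
  open ℤ.≤-Reasoning
  open +-*-Solver
  v = proj₁ good-signs
  count = length (filter (multiplicative? G (ĝ v)) (cartesianProduct elements elements))
  2n² = + 2 ℤ.* (+ order ℤ.* + order)
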